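{- Let $G$ be a graph of order $n$ such that $\gamma_2(G)\ge 2$. Then $st_{\gamma_2}(G)\le n-\gamma_2(G)+1$.
   Context: All graphs are finite, simple and undirected. For a graph $G=(V,E)$, a subset $D \subseteq V$ is a 2-dominating set if every vertex $v \in V \setminus D$ has at least two neighbors in $D$. The 2-domination number $\gamma_2(G)$ is the minimum cardinality of a 2-dominating set of $G$. The stability of the 2-domination number, $st_{\gamma_2}(G)$, is the minimum number of vertices whose removal from $G$ (deleting the vertices and all incident edges) changes the 2-domination number, i.e. the minimum of $|S|$ over $S\subseteq V$ with $\gamma_2(G-S)\ne\gamma_2(G)$. -}

module Defs where

open import Level using (0ℓ)
open import Data.Bool.Base using (if_then_else_)
open import Data.Nat.Base using (ℕ; zero; suc; _∸_; _≤_; z≤n; s≤s)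
open import Data.Nat.Properties using (_≤?_; _≟_; n≤0⇒n≡0; n∸n≡0; ≤-trans; ≤-reflexive)
open import Data.Fin.Base using (Fin; zero; suc)
open import Data.Fin.Properties using (all?; suc-injective)
open import Data.Fin.Subset using (Subset; inside; outside; _∉_; _∩_; ∁; ⊤; ∣_∣)
open import Data.Fin.Subset.Properties using (_∈?_; anySubset?; ∣p∣≤n; ∈⊤; ∣⊤∣≡n; ∣∁p∣≡n∸∣p∣)
open import Data.Vec.Base using ([]; _∷_; tabulate)
open import Data.Product.Base using (∃; _×_; _,_)
open import Data.Empty using (⊥-elim)
open import Function.Base using (_∘_)
open import Relation.Nullary using (does; yes; no; ¬?; _×-dec_; _→-dec_)
open import Relation.Unary using (Pred) renaming (Decidable to Decidable₁)
open import Relation.Binary.Core using (Rel)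
open import Relation.Binary.Definitions using (Symmetric; Irreflexive; Decidable)
open import Relation.Binary.PropositionalEquality using (_≡_; _≢_; refl; sym; trans; cong)

record Graph (n : ℕ) : Set₁ where
  field
    Adj    : Rel (Fin n) 0ℓ
    adj?   : Decidable Adj
    symm   : Symmetric Adj
    irrefl : Irreflexive _≡_ Adj

open Graph public

-- The vertices of G − S are renumbered by Fin ∣ ∁ S ∣; `embed p` is the
-- increasing enumeration of the elements of p.
embed : ∀ {n} (p : Subset n) → Fin ∣ p ∣ → Fin n
embed (inside  ∷ p) zero    = zero
embed (inside  ∷ p) (suc i) = suc (embed p i)
embed (outside ∷ p) i       = suc (embed p i)

embed-injective : ∀ {n} (p : Subset n) {i j} → embed p i ≡ embed p j → i ≡ j
embed-injective (inside  ∷ p) {zero}  {zero}  _  = refl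
embed-injective (inside  ∷ p) {suc i} {suc j} eq = cong suc (embed-injective p (suc-injective eq))
embed-injective (outside ∷ p)                 eq = embed-injective p (suc-injective eq)

infixl 6 _−_

_−_ : ∀ {n} → Graph n → (S : Subset n) → Graph ∣ ∁ S ∣
G − S = record
  { Adj    = λ i j → Adj G (embed (∁ S) i) (embed (∁ S) j)
  ; adj?   = λ i j → adj? G (embed (∁ S) i) (embed (∁ S) j)
  ; symm   = symm G
  ; irrefl = λ i≡j → irrefl G (cong (embed (∁ S)) i≡j)
  }

N : ∀ {n} → Graph n → Fin n → Subset n
N G v = tabulate (does ∘ adj? G v)

2-Dominating : ∀ {n} → Graph n → Pred (Subset n) 0ℓ
2-Dominating G D = ∀ v → v ∉ D → 2 ≤ ∣ N G v ∩ D ∣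

2-dominating? : ∀ {n} (G : Graph n) → Decidable₁ (2-Dominating G)
2-dominating? G D = all? λ v → ¬? (v ∈? D) →-dec (2 ≤? ∣ N G v ∩ D ∣)

-- The least k < b satisfying P, or b if there is none.
least : {P : Pred ℕ 0ℓ} → Decidable₁ P → ℕ → ℕ
least P? zero    = zero
least P? (suc b) = if does (P? zero) then zero else suc (least (P? ∘ suc) b)

HasSize : ∀ {n} → Pred (Subset n) 0ℓ → Pred ℕ 0ℓ
HasSize P k = ∃ λ p → P p × ∣ p ∣ ≡ k

hasSize? : ∀ {n} {P : Pred (Subset n) 0ℓ} → Decidable₁ P → Decidable₁ (HasSize P)
hasSize? P? k = anySubset? λ p → P? p ×-dec (∣ p ∣ ≟ k)

-- The minimum cardinality of a subset satisfying P. A subset of Fin n has at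
-- most n elements, so the junk value suc n occurs exactly when no subset
-- satisfies P.
minSize : ∀ {n} {P : Pred (Subset n) 0ℓ} → Decidable₁ P → ℕ
minSize {n} P? = least (hasSize? P?) (suc n)

γ₂ : ∀ {n} → Graph n → ℕ
γ₂ G = minSize (2-dominating? G)

Changesγ₂ : ∀ {n} → Graph n → Pred (Subset n) 0ℓ
Changesγ₂ G S = γ₂ (G − S) ≢ γ₂ G

changesγ₂? : ∀ {n} (G : Graph n) → Decidable₁ (Changesγ₂ G)
changesγ₂? G S = ¬? (γ₂ (G − S) ≟ γ₂ G)

-- S may be all of the vertex set; the graph of order 0 has γ₂ = 0. Some S
-- changes γ₂ as soon as γ₂ G ≢ 0 (see st-isMinSize).
st : ∀ {n} → Graph n → ℕ
st G = minSize (changesγ₂? G)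

IsMinSize : ∀ {n} → Pred (Subset n) 0ℓ → ℕ → Set
IsMinSize P m = HasSize P m × (∀ q → P q → m ≤ ∣ q ∣)

least-holds : {P : Pred ℕ 0ℓ} (P? : Decidable₁ P) (b : ℕ) →
              ∀ {k} → suc k ≤ b → P k → P (least P? b)
least-holds P? (suc b) k<b pk with P? zero
least-holds P? (suc b) {k}     k<b       pk | yes p0 = p0
least-holds P? (suc b) {zero}  k<b       pk | no ¬p0 = ⊥-elim (¬p0 pk)
least-holds P? (suc b) {suc k} (s≤s k<b) pk | no ¬p0 = least-holds (P? ∘ suc) b k<b pk

least-≤ : {P : Pred ℕ 0ℓ} (P? : Decidable₁ P) (b : ℕ) → ∀ {k} → P k → least P? b ≤ k
least-≤ P? zero pk = z≤n
least-≤ P? (suc b) pk with P? zero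
least-≤ P? (suc b)         pk | yes _  = z≤n
least-≤ P? (suc b) {zero}  pk | no ¬p0 = ⊥-elim (¬p0 pk)
least-≤ P? (suc b) {suc k} pk | no _   = s≤s (least-≤ (P? ∘ suc) b pk)

minSize-isMinSize : ∀ {n} {P : Pred (Subset n) 0ℓ} (P? : Decidable₁ P) →
                    ∃ P → IsMinSize P (minSize P?)
minSize-isMinSize {n} P? (p , Pp) =
    least-holds (hasSize? P?) (suc n) (s≤s (∣p∣≤n p)) (p , Pp , refl)
  , λ q Pq → least-≤ (hasSize? P?) (suc n) (q , Pq , refl)

⊤-2-dominating : ∀ {n} (G : Graph n) → 2-Dominating G ⊤
⊤-2-dominating G v v∉⊤ = ⊥-elim (v∉⊤ ∈⊤)

γ₂-isMinSize : ∀ {n} (G : Graph n) → IsMinSize (2-Dominating G) (γ₂ G)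
γ₂-isMinSize G = minSize-isMinSize (2-dominating? G) (⊤ , ⊤-2-dominating G)

γ₂≤n : ∀ {n} (G : Graph n) → γ₂ G ≤ n
γ₂≤n {n} G with γ₂-isMinSize G
... | _ , min = ≤-trans (min ⊤ (⊤-2-dominating G)) (∣p∣≤n (⊤ {n}))

st-isMinSize : ∀ {n} (G : Graph n) → γ₂ G ≢ 0 →
               IsMinSize (Changesγ₂ G) (st G)
st-isMinSize {n} G γ≢0 =
  minSize-isMinSize (changesγ₂? G) (⊤ , λ eq → γ≢0 (trans (sym eq) γ₂[G−⊤]≡0))
  where
  ∣∁⊤∣≡0 : ∣ ∁ (⊤ {n}) ∣ ≡ 0
  ∣∁⊤∣≡0 = trans (∣∁p∣≡n∸∣p∣ (⊤ {n}))
                 (trans (cong (n ∸_) (∣⊤∣≡n n)) (n∸n≡0 n))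

  γ₂[G−⊤]≡0 : γ₂ (G − ⊤) ≡ 0
  γ₂[G−⊤]≡0 = n≤0⇒n≡0 (≤-trans (γ₂≤n (G − ⊤)) (≤-reflexive ∣∁⊤∣≡0))

{-# OPTIONS --safe #-}
module Submission where

open import Data.Nat.Base using (ℕ; suc; pred; _+_; _∸_; _≤_; _<_; z≤n; s≤s)
open import Data.Nat.Properties
  using (n≤1+n; n<1+n; m∸n≤m; m∸[m∸n]≡n; <⇒≢; m<n⇒n≢0; ≤-trans; ≤-reflexive; <⇒≤;
         +-comm; +-∸-assoc; module ≤-Reasoning)
open import Data.Fin.Subset using (Subset; inside; ⊥; ∁; ∣_∣)
open import Data.Fin.Subset.Properties using (∣⊥∣≡0; ∣∁p∣≡n∸∣p∣)
open import Data.Product.Base using (∃; _,_; proj₂)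
open import Data.Vec.Base using (_∷_)
open import Relation.Binary.PropositionalEquality using (_≡_; trans; cong)
open import Defs using (Graph; γ₂; st; _−_; γ₂≤n; st-isMinSize)

-- A graph has γ₂ at most its order, so deleting vertices until only γ₂ G ∸ 1
-- of them remain makes the 2-domination number drop, whichever are deleted.

-- Leaving `k` vertices costs `n ∸ k` deletions, so every `k < γ₂ G` bounds `st G` (`st≤n∸k`, via
-- `st≤∣S∣`); the largest such `k` gives the theorem.

subset-of-size : ∀ {k n} → k ≤ n → ∃ λ (p : Subset n) → ∣ p ∣ ≡ k
subset-of-size {n = n} z≤n = ⊥ , ∣⊥∣≡0 n
subset-of-size (s≤s k≤n) with p , ∣p∣≡k ← subset-of-size k≤n =
  inside ∷ p , cong suc ∣p∣≡k

st≤∣S∣ : ∀ {n} (G : Graph n) (S : Subset n) → ∣ ∁ S ∣ < γ₂ G → st G ≤ ∣ S ∣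
-- Since `γ₂ G` is nonzero, `st G` is a genuine minimum, not the default `suc n`.
st≤∣S∣ G S ∣∁S∣<γ = proj₂ (st-isMinSize G (m<n⇒n≢0 ∣∁S∣<γ)) S
  (<⇒≢ (≤-trans (s≤s (γ₂≤n (G − S))) ∣∁S∣<γ))

st≤n∸k : ∀ {n} (G : Graph n) {k} → k < γ₂ G → st G ≤ n ∸ k
st≤n∸k {n} G {k} k<γ with S , ∣S∣≡n∸k ← subset-of-size (m∸n≤m n k) = begin
  st G   ≤⟨ st≤∣S∣ G S (begin-strict
              ∣ ∁ S ∣      ≡⟨ ∣∁p∣≡n∸∣p∣ S ⟩
              n ∸ ∣ S ∣    ≡⟨ cong (n ∸_) ∣S∣≡n∸k ⟩
              -- Truncated subtraction cancels because `k < γ₂ G ≤ n`.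
              n ∸ (n ∸ k)  ≡⟨ m∸[m∸n]≡n (≤-trans (n≤1+n k) (≤-trans k<γ (γ₂≤n G))) ⟩
              k            <⟨ k<γ ⟩
              γ₂ G         ∎) ⟩
  ∣ S ∣  ≡⟨ ∣S∣≡n∸k ⟩
  n ∸ k  ∎
  where open ≤-Reasoning

-- Both hypotheses guard against truncation: the equation fails at `m = 0` and for `m > n`.
n∸pred[m]≡n∸m+1 : ∀ {m n} → 0 < m → m ≤ n → n ∸ pred m ≡ n ∸ m + 1
n∸pred[m]≡n∸m+1 {suc m} {n} _ m<n = trans (+-∸-assoc 1 m<n) (+-comm 1 (n ∸ suc m))

pred[m]<m : ∀ {m} → 0 < m → pred m < m
pred[m]<m {suc m} _ = n<1+n m

theorem3p6 : (n : ℕ) (G : Graph n) → 2 ≤ γ₂ G → st G ≤ n ∸ γ₂ G + 1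
theorem3p6 n G 2≤γ =
  ≤-trans (st≤n∸k G (pred[m]<m 0<γ)) (≤-reflexive (n∸pred[m]≡n∸m+1 0<γ (γ₂≤n G)))
  where
  0<γ : 0 < γ₂ G
  0<γ = <⇒≤ 2≤γ
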